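{- Let $m,n\in\mathbb{N}$ with $m\geq 3$ odd, and set $\ell := \lfloor m/2\rfloor$. Let $p\in\mathbb{Z}_m$ and $A\subseteq \mathcal{E}_m^n(p)$, and put $\alpha := |A|/m^{n-1}$. Then for each choice of sign, \[ |N_n(A, \mathcal{E}_m^n(p\pm 1))| \geq |A|\left(1 + \frac{1-\alpha}{\sqrt{\ell^3 m n}}\right). \]
   Context: The discrete torus $\mathbb{Z}_m^n$ is the graph with vertex set $\{0,1,\ldots,m-1\}^n$ in which $u,v$ are adjacent iff there is $j\in[n]$ with $u_j \equiv v_j \pm 1 \pmod m$ and $u_i=v_i$ for all $i\neq j$. For $p\in\mathbb{Z}_m$, $\mathcal{E}_m^n(p)$ is the set of vertices $v$ with $\sum_{i=1}^n v_i \equiv p \pmod m$. For vertex sets $X,Y$ of a graph $G$, $N_G(X) := \bigcup_{x\in X} N_G(x)\setminus X$ and $N_G(X,Y) := N_G(X)\cap Y$; here $N_n$ stands for $N_{\mathbb{Z}_m^n}$. -}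

module Defs where

open import Data.Bool using (Bool; true; false; _∧_; _∨_; not)
open import Data.Nat using (ℕ; zero; suc; _+_; _*_; _%_; _≡ᵇ_; NonZero; _≤_; _∸_; _^_)
open import Data.Product using (_×_)
open import Data.Fin using (Fin; toℕ)
open import Data.Vec using (Vec; []; _∷_)
open import Data.List using (List; []; _∷_; map; concatMap; filter; length)
open import Data.Bool.ListAction using (any)
open import Data.List using () renaming ([_] to [_]ₗ)
open import Data.Fin using () renaming (_≟_ to _≟ᶠ_)
open import Relation.Nullary.Decidable using (⌊_⌋)
import Data.List as L
open import Data.Bool using (T?)

Vertex : ℕ → ℕ → Set
Vertex m n = Vec (Fin m) n

VSet : ℕ → ℕ → Set
VSet m n = Vertex m n → Bool

allFinL : (m : ℕ) → List (Fin m)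
allFinL m = L.allFin m

vertices : (m n : ℕ) → List (Vertex m n)
vertices m zero    = [ [] ]ₗ
vertices m (suc n) = concatMap (λ i → map (i ∷_) (vertices m n)) (allFinL m)

card : {m n : ℕ} → VSet m n → ℕ
card {m} {n} X = length (filter (λ v → T? (X v)) (vertices m n))

pm1 : {m : ℕ} .{{_ : NonZero m}} → Fin m → Fin m → Bool
pm1 {m} x y = (toℕ x ≡ᵇ (suc (toℕ y)) % m) ∨ (toℕ y ≡ᵇ (suc (toℕ x)) % m)

eqF : {m : ℕ} → Fin m → Fin m → Bool
eqF x y = ⌊ x ≟ᶠ y ⌋

eqV : {m n : ℕ} → Vertex m n → Vertex m n → Bool
eqV []       []       = true
eqV (x ∷ u)  (y ∷ v)  = eqF x y ∧ eqV u v

adj : {m n : ℕ} .{{_ : NonZero m}} → Vertex m n → Vertex m n → Bool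
adj []       []       = false
adj (x ∷ u)  (y ∷ v)  = (pm1 x y ∧ eqV u v) ∨ (eqF x y ∧ adj u v)

coordSum : {m n : ℕ} → Vertex m n → ℕ
coordSum []      = 0
coordSum (x ∷ v) = toℕ x + coordSum v

layer : (m n : ℕ) .{{_ : NonZero m}} → ℕ → VSet m n
layer m n q v = coordSum v % m ≡ᵇ q % m

nbr : {m n : ℕ} .{{_ : NonZero m}} → VSet m n → VSet m n → VSet m n
nbr {m} {n} X Y v = Y v ∧ not (X v) ∧ any (λ u → X u ∧ adj u v) (vertices m n)

-- Real-free rendering of   N ≥ a (1 + (1 - a/M) / √K)   for naturals N, a, M, K with
-- M > 0, K > 0 and a ≤ M : equivalent to  a ≤ N  ∧  (a (M - a))² ≤ ((N - a) M)² K.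
BoundHolds : (N a M K : ℕ) → Set
BoundHolds N a M K = (a ≤ N) × ((a * (M ∸ a)) ^ 2 ≤ ((N ∸ a) * M) ^ 2 * K)

{-# OPTIONS --safe #-}

-- Induction on the dimension, slicing by the first coordinate.  Let aᵢ be the sizes of the
-- slices of A and aᵢ + eᵢ those of the slices of N(A).  The slice N(A)ᵢ contains both the
-- neighbourhood of Aᵢ and the slice of A next to i, so eᵢ obeys the inductive bound and
-- a_{i∓1} - aᵢ ≤ eᵢ.  Going around the cycle, |aᵢ - aⱼ| ≤ S := Σ eᵢ.  Put T = Σ aᵢ,
-- M = m^(n-1), K = ℓ³m.  Summing the inductive bounds gives Σ aᵢ(M - aᵢ) ≤ S M √(K n), and
-- the variance of the aᵢ, by which this falls short of T(mM - T)/m, is at most of order S².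
-- Since m² ≤ 4K, the loss is absorbed by passing from √n to √(n + 1).
module Submission where

open import Defs
open import Data.Bool using (true; false; T; T?; if_then_else_)
open import Data.Bool.Properties using (T-≡; T-not-≡; T-∧; T-∨)
open import Data.Fin using (Fin; zero; suc; toℕ; inject₁; fromℕ; opposite)
open import Data.Fin.Permutation using (reverse)
open import Data.Fin.Properties
  using (toℕ<n; toℕ≤pred[n]; toℕ-inject₁; toℕ-fromℕ; opposite-prop; opposite-involutive)
open import Data.List using ([]; _∷_; length; filter; map; concatMap; tabulate)
open import Data.List.Membership.Propositional using (_∈_; lose; find)
open import Data.List.Membership.Propositional.Properties using (∈-map⁺; ∈-concatMap⁺; ∈-allFin)
open import Data.List.Properties using (filter-++; length-++)
open import Data.List.Relation.Binary.Sublist.Propositional using (⊆-refl)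
open import Data.List.Relation.Binary.Sublist.Propositional.Properties using (filter⁺; length-mono-≤)
open import Data.List.Relation.Unary.Any using (here)
open import Data.List.Relation.Unary.Any.Properties using (any⁺; any⁻)
open import Data.Nat
open import Data.Nat.DivMod
open import Data.Nat.Properties
open import Data.Nat.Tactic.RingSolver using (solve-∀)
open import Data.Product using (_×_; _,_; proj₁; proj₂; ∃)
open import Data.Sum using (_⊎_; inj₁; inj₂)
open import Data.Unit using (tt)
open import Data.Vec using ([]; _∷_)
open import Function using (_∘_)
open import Function.Bundles using (Equivalence)
open import Relation.Binary.PropositionalEquality
open import Relation.Nullary using (¬_; yes; no; contradiction)
open import Relation.Nullary.Decidable using (fromWitness)
open import Algebra.Properties.Semiring.Sum +-*-semiring

open Equivalence using (to; from)
open ≤-Reasoning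

-- Inequalities between squares and products of naturals.

^2≡* : ∀ x → x ^ 2 ≡ x * x
^2≡* x = cong (x *_) (*-identityʳ x)

*-self-cancel-≤ : ∀ {x y} → x * x ≤ y * y → x ≤ y
*-self-cancel-≤ {x} {y} xx≤yy with x ≤? y
... | yes x≤y = x≤y
... | no  x≰y = contradiction (*-mono-< (≰⇒> x≰y) (≰⇒> x≰y)) (≤⇒≯ xx≤yy)

-- The square of |x - y| ≤ s, arranged so that no truncated subtraction occurs.
x²+y²≤2xy+s² : ∀ {x y s} → x ≤ y + s → y ≤ x + s → x * x + y * y ≤ 2 * (x * y) + s * s
x²+y²≤2xy+s² {x} {y} {s} x≤y+s y≤x+s with ≤-total x y
... | inj₁ x≤y with t , refl ← m≤n⇒∃[o]m+o≡n x≤y = begin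
  x * x + (x + t) * (x + t)   ≡⟨ identity x t ⟩
  2 * (x * (x + t)) + t * t   ≤⟨ +-monoʳ-≤ (2 * (x * (x + t))) (*-mono-≤ t≤s t≤s) ⟩
  2 * (x * (x + t)) + s * s   ∎
  where
  t≤s : t ≤ s
  t≤s = +-cancelˡ-≤ x t s y≤x+s
  identity : ∀ x t → x * x + (x + t) * (x + t) ≡ 2 * (x * (x + t)) + t * t
  identity = solve-∀
... | inj₂ y≤x with t , refl ← m≤n⇒∃[o]m+o≡n y≤x = begin
  (y + t) * (y + t) + y * y   ≡⟨ identity y t ⟩
  2 * ((y + t) * y) + t * t   ≤⟨ +-monoʳ-≤ (2 * ((y + t) * y)) (*-mono-≤ t≤s t≤s) ⟩
  2 * ((y + t) * y) + s * s   ∎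
  where
  t≤s : t ≤ s
  t≤s = +-cancelˡ-≤ y t s x≤y+s
  identity : ∀ y t → (y + t) * (y + t) + y * y ≡ 2 * ((y + t) * y) + t * t
  identity = solve-∀

4xy≤[x+y]² : ∀ x y → 4 * (x * y) ≤ (x + y) * (x + y)
4xy≤[x+y]² x y with ≤-total x y
... | inj₁ x≤y with t , refl ← m≤n⇒∃[o]m+o≡n x≤y =
  ≤-trans (m≤m+n _ (t * t)) (≤-reflexive (identity x t))
  where
  identity : ∀ x t → 4 * (x * (x + t)) + t * t ≡ (x + (x + t)) * (x + (x + t))
  identity = solve-∀
... | inj₂ y≤x with t , refl ← m≤n⇒∃[o]m+o≡n y≤x =
  ≤-trans (m≤m+n _ (t * t)) (≤-reflexive (identity y t))
  where
  identity : ∀ y t → 4 * ((y + t) * y) + t * t ≡ ((y + t) + y) * ((y + t) + y)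
  identity = solve-∀

-- The hypotheses say x ≤ y√k and x′ ≤ y′√k without the root; their product is the square of the
-- conclusion.
x²≤y²k⇒xx′≤yy′k : ∀ {x x′ y y′ k} → x * x ≤ y * y * k → x′ * x′ ≤ y′ * y′ * k →
                  x * x′ ≤ y * y′ * k
x²≤y²k⇒xx′≤yy′k {x} {x′} {y} {y′} {k} h h′ = *-self-cancel-≤ (begin
  (x * x′) * (x * x′)               ≡⟨ [m*n]*[o*p]≡[m*o]*[n*p] x x′ x x′ ⟩
  (x * x) * (x′ * x′)               ≤⟨ *-mono-≤ h h′ ⟩
  (y * y * k) * (y′ * y′ * k)       ≡⟨ identity y y′ k ⟩
  (y * y′ * k) * (y * y′ * k)       ∎)
  where
  identity : ∀ y y′ k → (y * y * k) * (y′ * y′ * k) ≡ (y * y′ * k) * (y * y′ * k)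
  identity = solve-∀

-- Finite sums and the numerical induction step.

sum-mono-≤ : ∀ {n} {f g : Fin n → ℕ} → (∀ i → f i ≤ g i) → sum f ≤ sum g
sum-mono-≤ {zero}  f≤g = z≤n
sum-mono-≤ {suc n} f≤g = +-mono-≤ (f≤g zero) (sum-mono-≤ (f≤g ∘ suc))

sum-const : ∀ n c → sum {n} (λ _ → c) ≡ n * c
sum-const zero    c = refl
sum-const (suc n) c = cong (c +_) (sum-const n c)

-- Root-free form of adding up the inequalities xᵢ ≤ yᵢ√k; the cross terms of the squared sum are
-- bounded by `x²≤y²k⇒xx′≤yy′k`.
sum-square-bound : ∀ {n} (x y : Fin n → ℕ) k → (∀ i → x i * x i ≤ y i * y i * k) →
                   sum x * sum x ≤ sum y * sum y * k
sum-square-bound {zero}  x y k h = z≤n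
sum-square-bound {suc n} x y k h = begin
  (x₀ + X) * (x₀ + X)                                   ≡⟨ expand x₀ X ⟩
  x₀ * x₀ + 2 * (x₀ * X) + X * X                        ≤⟨ +-mono-≤ (+-mono-≤ (h zero)
      (*-monoʳ-≤ 2 (x²≤y²k⇒xx′≤yy′k {x₀} {X} {y₀} {Y} (h zero) tail-bound))) tail-bound ⟩
  y₀ * y₀ * k + 2 * (y₀ * Y * k) + Y * Y * k            ≡⟨ collect y₀ Y k ⟩
  (y₀ + Y) * (y₀ + Y) * k                               ∎
  where
  x₀ X y₀ Y : ℕ
  x₀ = x zero
  X  = sum (x ∘ suc)
  y₀ = y zero
  Y  = sum (y ∘ suc)
  tail-bound : X * X ≤ Y * Y * k
  tail-bound = sum-square-bound (x ∘ suc) (y ∘ suc) k (h ∘ suc)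
  expand : ∀ x₀ X → (x₀ + X) * (x₀ + X) ≡ x₀ * x₀ + 2 * (x₀ * X) + X * X
  expand = solve-∀
  collect : ∀ y₀ Y k → y₀ * y₀ * k + 2 * (y₀ * Y * k) + Y * Y * k ≡ (y₀ + Y) * (y₀ + Y) * k
  collect = solve-∀

-- A variance bound: add (aᵢ - aⱼ)² ≤ s² over all m² pairs, first over j in `row`, then over i.
sum-of-squares-bound : ∀ {m} (a : Fin m → ℕ) s → (∀ i j → a i ≤ a j + s) →
  2 * (m * sum (λ i → a i * a i)) ≤ 2 * (sum a * sum a) + m * m * (s * s)
sum-of-squares-bound {m} a s close = begin
  2 * (m * Q)                                       ≡⟨ double m Q ⟩
  m * Q + m * Q
    ≡⟨ cong₂ _+_ (*-distribˡ-sum {m} m (λ i → a i * a i)) (sym (sum-const m Q)) ⟩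
  sum (λ i → m * (a i * a i)) + sum {m} (λ _ → Q)   ≡⟨ ∑-distrib-+ {m} _ _ ⟨
  sum (λ i → m * (a i * a i) + Q)                   ≤⟨ sum-mono-≤ row ⟩
  sum (λ i → 2 * Σa * a i + m * (s * s))             ≡⟨ ∑-distrib-+ {m} _ _ ⟩
  sum (λ i → 2 * Σa * a i) + sum {m} (λ _ → m * (s * s))
    ≡⟨ cong₂ _+_ (*-distribˡ-sum (2 * Σa) a) (sym (sum-const m _)) ⟨
  2 * Σa * Σa + m * (m * (s * s))                     ≡⟨ cong₂ _+_ (*-assoc 2 Σa Σa) (sym (*-assoc m m _)) ⟩
  2 * (Σa * Σa) + m * m * (s * s)                     ∎
  where
  Q Σa : ℕ
  Q = sum (λ i → a i * a i)
  Σa = sum a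
  double : ∀ m Q → 2 * (m * Q) ≡ m * Q + m * Q
  double = solve-∀
  swap : ∀ x Σa → 2 * x * Σa ≡ 2 * Σa * x
  swap = solve-∀
  row : ∀ i → m * (a i * a i) + Q ≤ 2 * Σa * a i + m * (s * s)
  row i = begin
    m * (a i * a i) + Q                               ≡⟨ cong (_+ Q) (sum-const m _) ⟨
    sum {m} (λ _ → a i * a i) + Q                     ≡⟨ ∑-distrib-+ {m} _ _ ⟨
    sum (λ j → a i * a i + a j * a j)                 ≤⟨ sum-mono-≤ (λ j → x²+y²≤2xy+s² (close i j) (close j i)) ⟩
    sum (λ j → 2 * (a i * a j) + s * s)               ≡⟨ ∑-distrib-+ {m} _ _ ⟩
    sum (λ j → 2 * (a i * a j)) + sum {m} (λ _ → s * s)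
      ≡⟨ cong₂ _+_ (sum-cong-≗ (λ j → sym (*-assoc 2 (a i) (a j)))) (sum-const m _) ⟩
    sum (λ j → 2 * a i * a j) + m * (s * s)           ≡⟨ cong (_+ m * (s * s)) (*-distribˡ-sum (2 * a i) a) ⟨
    2 * a i * Σa + m * (s * s)                         ≡⟨ cong (_+ m * (s * s)) (swap (a i) Σa) ⟩
    2 * Σa * a i + m * (s * s)                         ∎

-- If the bound failed, then 2P ≤ 2mX + W with W = m²S² would give W (n + 1) < P, hence
-- (2n + 1) P ≤ (2n + 2) mX; squaring contradicts (2n + 1)² > 4n(n + 1).
rate-step : ∀ {m M K n P X S} → m * m ≤ 4 * K → 4 * P ≤ (m * M) * (m * M) →
  2 * P ≤ 2 * (m * X) + m * m * (S * S) → X * X ≤ (S * M) * (S * M) * (K * n) →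
  P * P ≤ (S * (m * M)) * (S * (m * M)) * (K * suc n)
rate-step {m} {M} {K} {n} {P} {X} {S} mm≤4K 4P≤ 2P≤ XX≤ = ≮⇒≥ λ G<PP →
  let
    W≤ : W * suc n < P
    W≤ = ≰⇒> λ P≤ → <⇒≱ (*-monoʳ-< 4 G<PP) (begin
      4 * (P * P)                     ≡⟨ i₁ P ⟩
      P * (4 * P)                     ≤⟨ *-mono-≤ P≤ 4P≤ ⟩
      W * suc n * ((m * M) * (m * M)) ≡⟨ i₂ W n m M ⟩
      W * suc n * (M * M) * (m * m)   ≤⟨ *-monoʳ-≤ (W * suc n * (M * M)) mm≤4K ⟩
      W * suc n * (M * M) * (4 * K)   ≡⟨ i₃ m M K n S ⟩
      4 * G                           ∎)
    linear : (2 * n + 1) * P ≤ 2 * suc n * (m * X)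
    linear = +-cancelʳ-≤ P _ _ (begin
      (2 * n + 1) * P + P                    ≡⟨ i₄ n P ⟩
      suc n * (2 * P)                        ≤⟨ *-monoʳ-≤ (suc n) 2P≤ ⟩
      suc n * (2 * (m * X) + W)              ≡⟨ i₅ n (m * X) W ⟩
      2 * suc n * (m * X) + W * suc n        ≤⟨ +-monoʳ-≤ (2 * suc n * (m * X)) (<⇒≤ W≤) ⟩
      2 * suc n * (m * X) + P                ∎)
    squared : P * P + 4 * n * suc n * (P * P) ≤ 4 * n * suc n * (P * P)
    squared = begin
      P * P + 4 * n * suc n * (P * P)                             ≡⟨ i₆ n P ⟩
      ((2 * n + 1) * P) * ((2 * n + 1) * P)                       ≤⟨ *-mono-≤ linear linear ⟩
      (2 * suc n * (m * X)) * (2 * suc n * (m * X))               ≡⟨ i₇ n m X ⟩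
      4 * (suc n * suc n) * (m * m) * (X * X)                     ≤⟨ *-monoʳ-≤ (4 * (suc n * suc n) * (m * m)) XX≤ ⟩
      4 * (suc n * suc n) * (m * m) * ((S * M) * (S * M) * (K * n)) ≡⟨ i₈ m M K n S ⟩
      4 * n * suc n * G                                           ≤⟨ *-monoʳ-≤ (4 * n * suc n) (<⇒≤ G<PP) ⟩
      4 * n * suc n * (P * P)                                     ∎
  in <⇒≱ G<PP (≤-trans (+-cancelʳ-≤ _ (P * P) 0 squared) z≤n)
  where
  W G : ℕ
  W = m * m * (S * S)
  G = (S * (m * M)) * (S * (m * M)) * (K * suc n)
  i₁ : ∀ P → 4 * (P * P) ≡ P * (4 * P)
  i₁ = solve-∀
  i₂ : ∀ W n m M → W * suc n * ((m * M) * (m * M)) ≡ W * suc n * (M * M) * (m * m)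
  i₂ = solve-∀
  i₃ : ∀ m M K n S → m * m * (S * S) * suc n * (M * M) * (4 * K) ≡
       4 * ((S * (m * M)) * (S * (m * M)) * (K * suc n))
  i₃ = solve-∀
  i₄ : ∀ n P → (2 * n + 1) * P + P ≡ suc n * (2 * P)
  i₄ = solve-∀
  i₅ : ∀ n Y W → suc n * (2 * Y + W) ≡ 2 * suc n * Y + W * suc n
  i₅ = solve-∀
  i₆ : ∀ n P → P * P + 4 * n * suc n * (P * P) ≡ ((2 * n + 1) * P) * ((2 * n + 1) * P)
  i₆ = solve-∀
  i₇ : ∀ n m X → (2 * suc n * (m * X)) * (2 * suc n * (m * X)) ≡ 4 * (suc n * suc n) * (m * m) * (X * X)
  i₇ = solve-∀
  i₈ : ∀ m M K n S → 4 * (suc n * suc n) * (m * m) * ((S * M) * (S * M) * (K * n)) ≡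
       4 * n * suc n * ((S * (m * M)) * (S * (m * M)) * (K * suc n))
  i₈ = solve-∀

isoperimetric-step : ∀ {m} M K n (a e : Fin m → ℕ) → m * m ≤ 4 * K → (∀ i → a i ≤ M) →
  (∀ i j → a i ≤ a j + sum e) →
  (∀ i → (a i * (M ∸ a i)) ^ 2 ≤ (e i * M) ^ 2 * (K * n)) →
  (sum a * (m * M ∸ sum a)) ^ 2 ≤ (sum e * (m * M)) ^ 2 * (K * suc n)
isoperimetric-step {m} M K n a e mm≤4K a≤M close local =
  subst₂ (λ x y → x ≤ y * (K * suc n)) (sym (^2≡* P)) (sym (^2≡* (S * (m * M))))
    (rate-step {m} {M} {K} {n} {P} {X} {S} mm≤4K 4P≤ 2P≤ XX≤)
  where
  Σa S P X Q : ℕ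
  Σa = sum a
  S = sum e
  P = Σa * (m * M ∸ Σa)
  X = sum (λ i → a i * (M ∸ a i))
  Q = sum (λ i → a i * a i)
  Σa≤mM : Σa ≤ m * M
  Σa≤mM = ≤-trans (sum-mono-≤ a≤M) (≤-reflexive (sum-const m M))
  complete-square : ∀ {x y} → x ≤ y → x * (y ∸ x) + x * x ≡ y * x
  complete-square {x} {y} x≤y = trans (sym (*-distribˡ-+ x (y ∸ x) x))
    (trans (cong (x *_) (m∸n+n≡m x≤y)) (*-comm x y))
  X+Q≡MΣa : X + Q ≡ M * Σa
  X+Q≡MΣa = trans (sym (∑-distrib-+ {m} _ _))
    (trans (sum-cong-≗ (λ i → complete-square (a≤M i))) (sym (*-distribˡ-sum M a)))
  -- Both sides equal m M Σa. Hence P exceeds m X by exactly m Q - (Σa)², the variance term that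
  -- `sum-of-squares-bound` controls.
  P+Σa²≡m[X+Q] : P + Σa * Σa ≡ m * (X + Q)
  P+Σa²≡m[X+Q] = trans (complete-square Σa≤mM)
    (trans (*-assoc m M Σa) (cong (m *_) (sym X+Q≡MΣa)))
  -- The two factors of `P` add up to m M, so this is the inequality of arithmetic and geometric
  -- means.
  4P≤ : 4 * P ≤ (m * M) * (m * M)
  4P≤ = subst (λ x → 4 * P ≤ x * x) (m+[n∸m]≡n Σa≤mM) (4xy≤[x+y]² Σa (m * M ∸ Σa))
  2P≤ : 2 * P ≤ 2 * (m * X) + m * m * (S * S)
  2P≤ = +-cancelʳ-≤ (2 * (Σa * Σa)) _ _ (begin
    2 * P + 2 * (Σa * Σa)                                 ≡⟨ *-distribˡ-+ 2 P (Σa * Σa) ⟨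
    2 * (P + Σa * Σa)                                     ≡⟨ cong (2 *_) P+Σa²≡m[X+Q] ⟩
    2 * (m * (X + Q))                                   ≡⟨ expand m X Q ⟩
    2 * (m * X) + 2 * (m * Q)                           ≤⟨ +-monoʳ-≤ (2 * (m * X)) (sum-of-squares-bound a S close) ⟩
    2 * (m * X) + (2 * (Σa * Σa) + m * m * (S * S))       ≡⟨ rotate (2 * (m * X)) (2 * (Σa * Σa)) (m * m * (S * S)) ⟩
    2 * (m * X) + m * m * (S * S) + 2 * (Σa * Σa)         ∎)
    where
    expand : ∀ m X Q → 2 * (m * (X + Q)) ≡ 2 * (m * X) + 2 * (m * Q)
    expand = solve-∀
    rotate : ∀ x y z → x + (y + z) ≡ x + z + y
    rotate = solve-∀
  XX≤ : X * X ≤ (S * M) * (S * M) * (K * n)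
  XX≤ = subst (λ s → X * X ≤ s * s * (K * n)) (sym (*-distribʳ-sum M e))
    (sum-square-bound _ (λ i → e i * M) (K * n) λ i →
      subst₂ (λ x y → x ≤ y * (K * n)) (^2≡* (a i * (M ∸ a i))) (^2≡* (e i * M)) (local i))

-- Residues of coordinate sums.

%-cong-+ʳ : ∀ a b c m .{{_ : NonZero m}} → a % m ≡ b % m → (a + c) % m ≡ (b + c) % m
%-cong-+ʳ a b c m a≡b = trans (%-distribˡ-+ a c m)
  (trans (cong (λ x → (x + c % m) % m) a≡b) (sym (%-distribˡ-+ b c m)))

-- With d = k + 1, the product `m * k` serves as -m modulo d; adding it to both sides cancels m.
[m+n]%d≡m%d⇒n%d≡0 : ∀ m n d .{{_ : NonZero d}} → (m + n) % d ≡ m % d → n % d ≡ 0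
[m+n]%d≡m%d⇒n%d≡0 m n (suc k) eq =
  trans (sym ([m+kn]%n≡m%n n m (suc k)))
    (trans (cong (_% suc k) (regroup m n k)) (trans (%-cong-+ʳ (m + n) m (m * k) (suc k) eq)
      (trans (cong (_% suc k) (sym (*-suc m k))) (m*n%n≡0 m (suc k)))))
  where
  regroup : ∀ m n k → n + m * suc k ≡ m + n + m * k
  regroup = solve-∀

-- `suc k ∸ toℕ i` stands for -i, so slice i of layer q lies in layer q - i, one dimension lower.
slice-% : ∀ {k} (i : Fin (suc k)) s q →
  (toℕ i + s) % suc k ≡ q % suc k → s % suc k ≡ (q + (suc k ∸ toℕ i)) % suc k
slice-% {k} i s q eq = trans (sym ([m+n]%n≡m%n s (suc k)))
  (trans (cong (_% suc k) (sym i+s+m∸i≡s+m)) (%-cong-+ʳ (toℕ i + s) q (suc k ∸ toℕ i) (suc k) eq))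
  where
  i+s+m∸i≡s+m : toℕ i + s + (suc k ∸ toℕ i) ≡ s + suc k
  i+s+m∸i≡s+m = trans (cong (_+ (suc k ∸ toℕ i)) (+-comm (toℕ i) s))
    (trans (+-assoc s (toℕ i) _) (cong (s +_) (m+[n∸m]≡n (<⇒≤ (toℕ<n i)))))

unslice-% : ∀ {k} (i : Fin (suc k)) s q r →
  s % suc k ≡ (q + (suc k ∸ toℕ i) + r) % suc k → (toℕ i + s) % suc k ≡ (q + r) % suc k
unslice-% {k} i s q r eq = trans (cong (_% suc k) (+-comm (toℕ i) s))
  (trans (%-cong-+ʳ s (q + (suc k ∸ toℕ i) + r) (toℕ i) (suc k) eq)
    (trans (cong (_% suc k) regroup) ([m+n]%n≡m%n (q + r) (suc k))))
  where
  swap : ∀ q d r i → q + d + r + i ≡ q + r + (d + i)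
  swap = solve-∀
  regroup : q + (suc k ∸ toℕ i) + r + toℕ i ≡ q + r + suc k
  regroup = trans (swap q _ r _) (cong (q + r +_) (m∸n+n≡m (<⇒≤ (toℕ<n i))))

-- Used with x = `toℕ (π i)` and y = `toℕ i`: changing the first coordinate from `π i` to `i` moves
-- a vertex from layer q to layer q + r.
rotate-% : ∀ x y r s q m .{{_ : NonZero m}} → (x + r) % m ≡ y % m →
  (x + s) % m ≡ q % m → (y + s) % m ≡ (q + r) % m
rotate-% x y r s q m x+r≡y x+s≡q = trans (sym (%-cong-+ʳ (x + r) y s m x+r≡y))
  (trans (cong (_% m) (swap x r s)) (%-cong-+ʳ (x + s) q r m x+s≡q))
  where
  swap : ∀ x r s → x + r + s ≡ x + s + r
  swap = solve-∀

-- Rotations of the cycle by one place.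

-- What the induction needs from i ↦ i - r, for r = 1 or r = k (that is, -1), so that one argument
-- covers both signs. `drift` says that one-step losses accumulate to at most one full turn.
record Rotation (k r : ℕ) (π : Fin (suc k) → Fin (suc k)) : Set where
  field
    adjacent  : ∀ i → T (pm1 (π i) i)
    shift     : ∀ i → (toℕ (π i) + r) % suc k ≡ toℕ i % suc k
    invariant : ∀ f → sum (f ∘ π) ≡ sum f
    drift     : ∀ (a e : Fin (suc k) → ℕ) → (∀ i → a (π i) ≤ a i + e i) →
                ∀ i j → a i ≤ a j + sum e

cyclicPred : ∀ {k} → Fin (suc k) → Fin (suc k)
cyclicPred {k} zero    = fromℕ k
cyclicPred     (suc i) = inject₁ i

-- Conjugation by the reversal lets the facts about `cyclicPred` be transported instead of proved
-- again.
cyclicSuc : ∀ {k} → Fin (suc k) → Fin (suc k)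
cyclicSuc = opposite ∘ cyclicPred ∘ opposite

Descending : ∀ {k} → (a e : Fin (suc k) → ℕ) → Set
Descending {k} a e = ∀ (i : Fin k) → a (inject₁ i) ≤ a (suc i) + e (suc i)

chain : ∀ {x y} z d s → x ≤ y + d → y ≤ z + s → x ≤ z + (d + s)
chain {x} {y} z d s x≤y+d y≤z+s = begin
  x            ≤⟨ x≤y+d ⟩
  y + d        ≤⟨ +-monoˡ-≤ d y≤z+s ⟩
  z + s + d    ≡⟨ +-assoc z s d ⟩
  z + (s + d)  ≡⟨ cong (z +_) (+-comm s d) ⟩
  z + (d + s)  ∎

-- Follow the steps from index 0 up to j. The sum omits `e zero`, which is kept for the step that
-- wraps around.
from-first : ∀ {k} (a e : Fin (suc k) → ℕ) → Descending a e →
             ∀ j → a zero ≤ a j + sum (e ∘ suc)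
from-first a e desc zero = m≤m+n _ _
from-first {suc k} a e desc (suc j) =
  chain (a (suc j)) (e (suc zero)) _ (desc zero) (from-first (a ∘ suc) (e ∘ suc) (desc ∘ suc) j)

to-last : ∀ {k} (a e : Fin (suc k) → ℕ) → Descending a e →
          ∀ i → a i ≤ a (fromℕ k) + sum (e ∘ suc)
to-last {k} a e desc zero = from-first a e desc (fromℕ k)
to-last {suc k} a e desc (suc i) = ≤-trans (to-last (a ∘ suc) (e ∘ suc) (desc ∘ suc) i)
  (+-monoʳ-≤ (a (fromℕ (suc k))) (m≤n+m _ (e (suc zero))))

-- The right-hand alternative covers the case of i after j: the path from i wraps
-- around from the last index to the first.
between : ∀ {k} (a e : Fin (suc k) → ℕ) → Descending a e → ∀ i j →
  (a i ≤ a j + sum (e ∘ suc)) ⊎ (a i + a zero ≤ a j + a (fromℕ k) + sum (e ∘ suc))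
between a e desc zero j = inj₁ (from-first a e desc j)
between {suc k} a e desc (suc i) zero = inj₂ (begin
  a (suc i) + a zero          ≡⟨ +-comm (a (suc i)) (a zero) ⟩
  a zero + a (suc i)          ≤⟨ +-monoʳ-≤ (a zero) (to-last a e desc (suc i)) ⟩
  a zero + (a (fromℕ (suc k)) + sum (e ∘ suc)) ≡⟨ +-assoc (a zero) _ _ ⟨
  a zero + a (fromℕ (suc k)) + sum (e ∘ suc)   ∎)
between {suc k} a e desc (suc i) (suc j)
  with between (a ∘ suc) (e ∘ suc) (desc ∘ suc) i j
... | inj₁ direct  = inj₁ (≤-trans direct (+-monoʳ-≤ (a (suc j)) (m≤n+m _ (e (suc zero)))))
... | inj₂ wrapped = inj₂ (chain (a (suc j) + a (fromℕ (suc k))) (e (suc zero)) _ (begin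
  a (suc i) + a zero                        ≤⟨ +-monoʳ-≤ (a (suc i)) (desc zero) ⟩
  a (suc i) + (a (suc zero) + e (suc zero)) ≡⟨ +-assoc (a (suc i)) _ _ ⟨
  a (suc i) + a (suc zero) + e (suc zero)   ∎) wrapped)

cyclicPred-drift : ∀ {k} (a e : Fin (suc k) → ℕ) → (∀ i → a (cyclicPred i) ≤ a i + e i) →
                   ∀ i j → a i ≤ a j + sum e
cyclicPred-drift {k} a e step i j with between a e (step ∘ suc) i j
... | inj₁ direct  = ≤-trans direct (+-monoʳ-≤ (a j) (m≤n+m _ (e zero)))
-- The path runs from i to the last index, crosses to 0 at cost `e zero`, then runs on to j; each
-- `e` is spent at most once.
... | inj₂ wrapped = +-cancelʳ-≤ (a zero) _ _ (begin
  a i + a zero                                ≤⟨ wrapped ⟩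
  a j + a (fromℕ k) + sum (e ∘ suc)           ≤⟨ +-monoˡ-≤ _ (+-monoʳ-≤ (a j) (step zero)) ⟩
  a j + (a zero + e zero) + sum (e ∘ suc)     ≡⟨ regroup (a j) (a zero) (e zero) _ ⟩
  a j + sum e + a zero                        ∎)
  where
  regroup : ∀ x y z w → x + (y + z) + w ≡ x + (z + w) + y
  regroup = solve-∀

-- The witness c counts turns of the cycle: 1 at the wrap-around, 0 elsewhere.
toℕ-cyclicPred : ∀ {k} (i : Fin (suc k)) → ∃ λ c → suc (toℕ (cyclicPred i)) ≡ toℕ i + c * suc k
toℕ-cyclicPred {k} zero    = 1 , cong suc (trans (toℕ-fromℕ k) (sym (+-identityʳ k)))
toℕ-cyclicPred     (suc i) = 0 , cong suc (trans (toℕ-inject₁ i) (sym (+-identityʳ _)))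

toℕ-opposite : ∀ {k} (i : Fin (suc k)) → toℕ (opposite i) + toℕ i ≡ k
toℕ-opposite i = trans (cong (_+ toℕ i) (opposite-prop i)) (m∸n+n≡m (toℕ≤pred[n] i))

toℕ-cyclicSuc : ∀ {k} (i : Fin (suc k)) → ∃ λ c → suc (toℕ i) ≡ toℕ (cyclicSuc i) + c * suc k
toℕ-cyclicSuc {k} i with c , eq ← toℕ-cyclicPred (opposite i) =
  -- After adding x both sides equal k + 1, since an index and its opposite add up to k.
  c , +-cancelˡ-≡ x _ _ (begin-equality
    x + suc (toℕ i)         ≡⟨ trans (+-suc x (toℕ i)) (cong suc (toℕ-opposite i)) ⟩
    suc k                   ≡⟨ cong suc (toℕ-opposite (cyclicPred (opposite i))) ⟨
    suc (z + y)             ≡⟨ +-suc z y ⟨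
    z + suc y               ≡⟨ cong (z +_) eq ⟩
    z + (x + c * suc k)     ≡⟨ swap z x (c * suc k) ⟩
    x + (z + c * suc k)     ∎)
  where
  x y z : ℕ
  x = toℕ (opposite i)
  y = toℕ (cyclicPred (opposite i))
  z = toℕ (cyclicSuc i)
  swap : ∀ z x w → z + (x + w) ≡ x + (z + w)
  swap = solve-∀

successor-% : ∀ {k} x (y : Fin (suc k)) → (∃ λ c → x ≡ toℕ y + c * suc k) → toℕ y ≡ x % suc k
successor-% {k} x y (c , eq) = trans (sym (m<n⇒m%n≡m (toℕ<n y)))
  (sym (trans (cong (_% suc k) eq) ([m+kn]%n≡m%n (toℕ y) c (suc k))))

cyclicPred-rotation : ∀ {k} → Rotation k 1 cyclicPred
cyclicPred-rotation {k} = record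
  { adjacent  = λ i → from T-∨ (inj₂ (≡⇒≡ᵇ _ _ (successor-% _ i (toℕ-cyclicPred i))))
  ; shift     = λ i → let c , eq = toℕ-cyclicPred i in
      trans (cong (_% suc k) (trans (+-comm _ 1) eq)) ([m+kn]%n≡m%n (toℕ i) c (suc k))
  ; invariant = λ f → trans (+-comm (f (fromℕ k)) _) (sym (sum-init-last f))
  ; drift     = cyclicPred-drift
  }

cyclicSuc-rotation : ∀ {k} → Rotation k k cyclicSuc
cyclicSuc-rotation {k} = record
  { adjacent  = λ i → from T-∨ (inj₁ (≡⇒≡ᵇ _ _ (successor-% _ (cyclicSuc i) (toℕ-cyclicSuc i))))
  ; shift     = λ i → let c , eq = toℕ-cyclicSuc i in begin-equality
      (toℕ (cyclicSuc i) + k) % suc k               ≡⟨ [m+kn]%n≡m%n (toℕ (cyclicSuc i) + k) c (suc k) ⟨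
      (toℕ (cyclicSuc i) + k + c * suc k) % suc k   ≡⟨ cong (_% suc k) (swap (toℕ (cyclicSuc i)) k (c * suc k)) ⟩
      (toℕ (cyclicSuc i) + c * suc k + k) % suc k   ≡⟨ cong (λ x → (x + k) % suc k) eq ⟨
      (suc (toℕ i) + k) % suc k                     ≡⟨ cong (_% suc k) (+-suc (toℕ i) k) ⟨
      (toℕ i + suc k) % suc k                       ≡⟨ [m+n]%n≡m%n (toℕ i) (suc k) ⟩
      toℕ i % suc k                                 ∎
  ; invariant = λ f → trans (sym (sum-opposite (f ∘ opposite ∘ cyclicPred)))
      (trans (Rotation.invariant cyclicPred-rotation (f ∘ opposite)) (sym (sum-opposite f)))
  ; drift     = λ a e step i j → subst₂ _≤_ (cong a (opposite-involutive i))
      (cong₂ _+_ (cong a (opposite-involutive j)) (sym (sum-opposite e)))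
      (cyclicPred-drift (a ∘ opposite) (e ∘ opposite)
        (λ l → subst (λ x → a (opposite (cyclicPred x)) ≤ a (opposite l) + e (opposite l))
          (opposite-involutive l) (step (opposite l)))
        (opposite i) (opposite j))
  }
  where
  swap : ∀ x y z → x + y + z ≡ x + z + y
  swap = solve-∀
  sum-opposite : ∀ f → sum f ≡ sum (f ∘ opposite)
  sum-opposite f = sum-permute f reverse

-- Slices, neighbourhoods and layers.

section : ∀ {m n} → VSet m (suc n) → Fin m → VSet m n
section X i w = X (i ∷ w)

card-mono : ∀ {m n} {X Y : VSet m n} → (∀ v → T (X v) → T (Y v)) → card X ≤ card Y
card-mono {m} {n} {X} {Y} X⊆Y = length-mono-≤
  (filter⁺ (T? ∘ X) (T? ∘ Y) (λ { refl → X⊆Y _ }) (⊆-refl {x = vertices m n}))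

card-section : ∀ {m n} (X : VSet m (suc n)) → card X ≡ sum (λ i → card (section X i))
card-section {m} {n} X = go (λ i → i)
  where
  filter-map : ∀ i ws → length (filter (T? ∘ X) (map (i ∷_) ws)) ≡
                        length (filter (T? ∘ section X i) ws)
  filter-map i []       = refl
  filter-map i (w ∷ ws) with X (i ∷ w)
  ... | true  = cong suc (filter-map i ws)
  ... | false = filter-map i ws
  -- A general `f` is needed for the recursion, since the tail of `tabulate f` is
  -- `tabulate (f ∘ suc)`.
  go : ∀ {l} (f : Fin l → Fin m) →
       length (filter (T? ∘ X) (concatMap (λ i → map (i ∷_) (vertices m n)) (tabulate f))) ≡
       sum (λ j → card (section X (f j)))
  go {zero}  f = refl
  go {suc l} f = trans (cong length (filter-++ (T? ∘ X) (map (f zero ∷_) (vertices m n)) _))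
    (trans (length-++ (filter (T? ∘ X) (map (f zero ∷_) (vertices m n))))
      (cong₂ _+_ (filter-map (f zero) (vertices m n)) (go (f ∘ suc))))

∈-vertices : ∀ {m n} (v : Vertex m n) → v ∈ vertices m n
∈-vertices []      = here refl
∈-vertices (i ∷ v) = ∈-concatMap⁺ _ (lose (∈-allFin i) (∈-map⁺ (i ∷_) (∈-vertices v)))

eqF-refl : ∀ {m} (i : Fin m) → T (eqF i i)
eqF-refl i = fromWitness refl

eqV-refl : ∀ {m n} (v : Vertex m n) → T (eqV v v)
eqV-refl []      = tt
eqV-refl (i ∷ v) = from T-∧ (eqF-refl i , eqV-refl v)

nbr⁺ : ∀ {m n} .{{_ : NonZero m}} (X Y : VSet m n) {v} u →
       T (Y v) → ¬ T (X v) → T (X u) → T (adj u v) → T (nbr X Y v)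
nbr⁺ X Y u v∈Y v∉X u∈X u~v = from T-∧ (v∈Y , from T-∧
  ( from T-not-≡ (¬T⇒≡false v∉X)
  , any⁺ _ (lose (∈-vertices u) (from T-∧ (u∈X , u~v)))))
  where
  ¬T⇒≡false : ∀ {b} → ¬ T b → b ≡ false
  ¬T⇒≡false {false} _  = refl
  ¬T⇒≡false {true}  ¬t = contradiction tt ¬t

nbr⁻ : ∀ {m n} .{{_ : NonZero m}} (X Y : VSet m n) {v} → T (nbr X Y v) →
       T (Y v) × ¬ T (X v) × ∃ λ u → T (X u) × T (adj u v)
nbr⁻ {m} {n} X Y {v} t with to T-∧ t
... | v∈Y , t′ with to T-∧ t′
... | v∉X , t″ with find (any⁻ _ (vertices m n) t″)
... | u , _ , u∧ = v∈Y , (λ v∈X → subst T (to T-not-≡ v∉X) v∈X) , u , to T-∧ u∧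

InLayer : ∀ {k n} → ℕ → VSet (suc k) n → Set
InLayer {k} q A = ∀ v → T (A v) → coordSum v % suc k ≡ q % suc k

section-InLayer : ∀ {k n} q {A : VSet (suc k) (suc n)} → InLayer q A → ∀ i →
                  InLayer (q + (suc k ∸ toℕ i)) (section A i)
section-InLayer q A⊆ i w w∈ = slice-% i (coordSum w) q (A⊆ (i ∷ w) w∈)

sum-indicator≤1 : ∀ n c → sum {n} (λ i → if toℕ i ≡ᵇ c then 1 else 0) ≤ 1
sum-indicator≤1 zero    c       = z≤n
sum-indicator≤1 (suc n) zero    = ≤-reflexive (cong suc (sum-replicate-zero n))
sum-indicator≤1 (suc n) (suc c) = sum-indicator≤1 n c

-- All coordinates but the last are free; the base case says that the last one is then forced modulo
-- `suc k`.
card-InLayer : ∀ {k} n q (A : VSet (suc k) (suc n)) → InLayer q A → card A ≤ suc k ^ n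
card-InLayer {k} zero q A A⊆ = begin
  card A                                                      ≡⟨ card-section A ⟩
  sum (λ i → card (section A i))                              ≤⟨ sum-mono-≤ point ⟩
  sum {suc k} (λ i → if toℕ i ≡ᵇ q % suc k then 1 else 0)     ≤⟨ sum-indicator≤1 (suc k) (q % suc k) ⟩
  1                                                           ∎
  where
  point : ∀ i → card (section A i) ≤ (if toℕ i ≡ᵇ q % suc k then 1 else 0)
  point i with A (i ∷ []) in eq
  ... | false = z≤n
  ... | true  = ≤-reflexive (sym (cong (if_then 1 else 0) (to T-≡ (≡⇒≡ᵇ _ _ i≡q))))
    where
    i≡q : toℕ i ≡ q % suc k
    i≡q = trans (sym (m<n⇒m%n≡m (toℕ<n i)))
      (trans (cong (_% suc k) (sym (+-identityʳ (toℕ i)))) (A⊆ (i ∷ []) (from T-≡ eq)))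
card-InLayer {k} (suc n) q A A⊆ = begin
  card A                             ≡⟨ card-section A ⟩
  sum (λ i → card (section A i))     ≤⟨ sum-mono-≤ (λ i →
    card-InLayer n (q + (suc k ∸ toℕ i)) (section A i) (section-InLayer q A⊆ i)) ⟩
  sum {suc k} (λ _ → suc k ^ n)      ≡⟨ sum-const (suc k) (suc k ^ n) ⟩
  suc k * suc k ^ n                  ∎

-- The isoperimetric inequality by induction on the dimension.

module _ {k r π} (rotation : Rotation k r π) (r≢0 : r % suc k ≢ 0) where
  open Rotation rotation

  private
    m = suc k
    N : ∀ {n} → ℕ → VSet m n → VSet m n
    N {n} q A = nbr A (layer m n (q + r))

  -- Changing the first coordinate from `π i` to `i` is an edge of the torus into layer q + r.
  rotated-section⊆nbr : ∀ {n} q (A : VSet m (suc n)) → InLayer q A → ∀ i w →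
                        T (section A (π i) w) → T (section (N q A) i w)
  rotated-section⊆nbr q A A⊆ i w w∈ = nbr⁺ A (layer m _ (q + r)) (π i ∷ w)
    (≡⇒≡ᵇ _ _ i+w≡q+r)
    -- A vertex of `A` in layer q + r would lie in layer q as well, forcing r ≡ 0.
    (λ i∷w∈A → r≢0 ([m+n]%d≡m%d⇒n%d≡0 q r m (trans (sym i+w≡q+r) (A⊆ (i ∷ w) i∷w∈A))))
    w∈
    (from T-∨ (inj₁ (from T-∧ (adjacent i , eqV-refl w))))
    where
    i+w≡q+r : (toℕ i + coordSum w) % m ≡ (q + r) % m
    i+w≡q+r = rotate-% (toℕ (π i)) (toℕ i) r (coordSum w) q m (shift i) (A⊆ (π i ∷ w) w∈)

  -- Edges within a slice are edges of the torus, and the layer (q - i) + r of slice i comes from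
  -- layer q + r.
  nbr-section⊆section-nbr : ∀ {n} q (A : VSet m (suc n)) i w →
    T (N (q + (m ∸ toℕ i)) (section A i) w) → T (section (N q A) i w)
  nbr-section⊆section-nbr q A i w t with nbr⁻ (section A i) (layer m _ (q + (m ∸ toℕ i) + r)) t
  ... | w∈layer , w∉A , u , u∈A , u~w = nbr⁺ A (layer m _ (q + r)) (i ∷ u)
    (≡⇒≡ᵇ _ _ (unslice-% i (coordSum w) q r (≡ᵇ⇒≡ _ _ w∈layer)))
    w∉A u∈A
    (from T-∨ (inj₂ (from T-∧ (eqF-refl i , u~w))))

  -- The slices of `A`, permuted by `π`, fit one by one into the slices of its neighbourhood.
  card≤card-nbr : ∀ {n} q (A : VSet m (suc n)) → InLayer q A → card A ≤ card (N q A)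
  card≤card-nbr q A A⊆ = begin
    card A                                ≡⟨ card-section A ⟩
    sum (λ i → card (section A i))        ≡⟨ invariant (λ i → card (section A i)) ⟨
    sum (λ i → card (section A (π i)))    ≤⟨ sum-mono-≤ (λ i → card-mono (rotated-section⊆nbr q A A⊆ i)) ⟩
    sum (λ i → card (section (N q A) i))  ≡⟨ card-section (N q A) ⟨
    card (N q A)                          ∎

  -- The dimension is `suc n`, so `m ^ n` is the size of a layer. In dimension one a layer is a
  -- single vertex, so the density is 0 or 1 and the left side vanishes.
  isoperimetry : ∀ K → m * m ≤ 4 * K → ∀ n q (A : VSet m (suc n)) → InLayer q A →
    BoundHolds (card (N q A)) (card A) (m ^ n) (K * suc n)
  isoperimetry K mm≤4K zero q A A⊆ =
    card≤card-nbr q A A⊆ , subst (λ x → x ^ 2 ≤ ((card (N q A) ∸ card A) * 1) ^ 2 * (K * 1))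
      (sym (no-deficit (card-InLayer 0 q A A⊆))) z≤n
    where
    no-deficit : ∀ {x} → x ≤ 1 → x * (1 ∸ x) ≡ 0
    no-deficit z≤n       = refl
    no-deficit (s≤s z≤n) = refl
  isoperimetry K mm≤4K (suc n) q A A⊆ = card≤card-nbr q A A⊆ ,
    subst₂ (λ x y → (x * (m * m ^ n ∸ x)) ^ 2 ≤ (y * (m * m ^ n)) ^ 2 * (K * suc (suc n)))
      (sym (card-section A)) sum-e≡
      (isoperimetric-step (m ^ n) K (suc n) a e mm≤4K
        (λ i → card-InLayer n (q + (suc k ∸ toℕ i)) (section A i) (section-InLayer q A⊆ i))
        (drift a e (λ i → ≤-trans (card-mono (rotated-section⊆nbr q A A⊆ i))
          (≤-reflexive (sym (m+[n∸m]≡n (a≤b i))))))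
        -- The inductive bound concerns the neighbourhood of the slice; it passes to `e i` because
        -- that neighbourhood lies inside slice i of the full one.
        (λ i → ≤-trans (proj₂ (ih i))
          (*-monoˡ-≤ (K * suc n) (^-monoˡ-≤ 2 (*-monoˡ-≤ (m ^ n) (∸-monoˡ-≤ (a i) (N≤b i)))))))
    where
    a b e : Fin m → ℕ
    a i = card (section A i)
    b i = card (section (N q A) i)
    e i = b i ∸ a i
    ih : ∀ i → BoundHolds (card (N (q + (m ∸ toℕ i)) (section A i))) (a i) (m ^ n) (K * suc n)
    ih i = isoperimetry K mm≤4K n (q + (m ∸ toℕ i)) (section A i) (section-InLayer q A⊆ i)
    N≤b : ∀ i → card (N (q + (m ∸ toℕ i)) (section A i)) ≤ b i
    N≤b i = card-mono (nbr-section⊆section-nbr q A i)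
    a≤b : ∀ i → a i ≤ b i
    a≤b i = ≤-trans (proj₁ (ih i)) (N≤b i)
    sum-e≡ : sum e ≡ card (N q A) ∸ card A
    sum-e≡ = sym (begin-equality
      card (N q A) ∸ card A       ≡⟨ cong₂ _∸_ (card-section (N q A)) (card-section A) ⟩
      sum b ∸ sum a               ≡⟨ cong (_∸ sum a) (sum-cong-≗ (λ i → sym (m+[n∸m]≡n (a≤b i)))) ⟩
      sum (λ i → a i + e i) ∸ sum a ≡⟨ cong (_∸ sum a) (∑-distrib-+ a e) ⟩
      sum a + sum e ∸ sum a       ≡⟨ m+n∸m≡n (sum a) (sum e) ⟩
      sum e                       ∎)

-- The constant ℓ³m and the two signs.

-- Reduces to m = 2ℓ + 1 ≤ 4ℓ³ for ℓ ≥ 1. With ℓ = l + 1 the difference is the polynomial 1 + 10l +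
-- 12l² + 4l³ in `cube`.
odd-square-bound : ∀ m → 3 ≤ m → m % 2 ≡ 1 → m * m ≤ 4 * ((m / 2) ^ 3 * m)
odd-square-bound m 3≤m m-odd with m / 2 | trans (m≡m%n+[m/n]*n m 2) (cong (_+ m / 2 * 2) m-odd)
... | zero  | m≡1 = contradiction 3≤m (<⇒≱ (subst (_< 3) (sym m≡1) (s≤s (s≤s z≤n))))
... | suc l | m≡ = ≤-trans (*-monoˡ-≤ m (≤-trans (≤-reflexive m≡) (≤-trans (m≤m+n _ _) (≤-reflexive (cube l)))))
  (≤-reflexive (*-assoc 4 (suc l ^ 3) m))
  where
  cube : ∀ l → 1 + suc l * 2 + (1 + 10 * l + 12 * (l * l) + 4 * (l * l * l)) ≡
         4 * (suc l * (suc l * (suc l * 1)))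
  cube = solve-∀

theorem1p3 : (m n : ℕ) .{{_ : NonZero m}} → 3 ≤ m → m % 2 ≡ 1 → 1 ≤ n →
    (p : Fin m) → (A : VSet m n) →
    (∀ v → A v ≡ true → layer m n (toℕ p) v ≡ true) →
    BoundHolds (card (nbr A (layer m n (toℕ p + 1)))) (card A) (m ^ (n ∸ 1)) ((m / 2) ^ 3 * m * n)
    × BoundHolds (card (nbr A (layer m n (toℕ p + (m ∸ 1))))) (card A) (m ^ (n ∸ 1)) ((m / 2) ^ 3 * m * n)
theorem1p3 m@(suc k@(suc _)) (suc n) 3≤m m-odd 1≤n p A A⊆ =
  -- The signs + and - are r = 1 and r = m - 1; both lie strictly between 0 and m, so neither is 0
  -- modulo m.
  bound cyclicPred-rotation (s≤s z≤n) (s≤s (s≤s z≤n)) , bound cyclicSuc-rotation (s≤s z≤n) ≤-refl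
  where
  A⊆layer : InLayer (toℕ p) A
  A⊆layer v v∈A = ≡ᵇ⇒≡ _ _ (from T-≡ (A⊆ v (to T-≡ v∈A)))
  bound : ∀ {r π} → Rotation k r π → 0 < r → r < m →
          BoundHolds (card (nbr A (layer m (suc n) (toℕ p + r)))) (card A) (m ^ n) ((m / 2) ^ 3 * m * suc n)
  bound rotation 0<r r<m =
    isoperimetry rotation (λ r≡0 → <⇒≢ 0<r (trans (sym r≡0) (m<n⇒m%n≡m r<m)))
      ((m / 2) ^ 3 * m) (odd-square-bound m 3≤m m-odd) n (toℕ p) A A⊆layer
theorem1p3 (suc zero) _ (s≤s ())
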